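{- For every deterministic sink-finding algorithm $\mathcal{A}$ (in the vertex evaluation query model) and every $n\geq 2$, there exists an $n$-dimensional Matoušek-type USO on which $\mathcal{A}$ requires at least $n$ vertex evaluations to find the sink.
   Context: All vectors and matrices are over $GF(2)$; $\oplus$ denotes addition in $GF(2)$ (xor). The $n$-dimensional hypercube has vertex set $\{0,1\}^n$, and two vertices are adjacent iff they differ in exactly one coordinate. An orientation of the hypercube is given by an outmap function $o:\{0,1\}^n\to\{0,1\}^n$, where the edge $\{v,v\oplus e_i\}$ is directed away from $v$ iff $o(v)_i=1$; consistency requires $o(v)_i\neq o(v\oplus e_i)_i$ for all $v$ and $i$. A Unique Sink Orientation (USO) is an orientation in which every non-empty face of the hypercube has a unique sink (vertex with no outgoing edges within the face). An $n$-dimensional Matoušek-type USO is an orientation of the form $o(v)=M(v\oplus s)$ for all $v\in\{0,1\}^n$, where $M=PAP^T$ for some $n\times n$ permutation matrix $P$ and some invertible upper-triangular matrix $A\in\{0,1\}^{n\times n}$, and $s\in\{0,1\}^n$ (the sink). A sink-finding algorithm accesses the USO only through a vertex evaluation oracle: querying a vertex $v$ returns $o(v)$; its cost is the number of such queries, and it has found the sink when it can output the vertex $s$ with $o(s)=0$. -}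

module Defs where

open import Algebra.Bundles using (CommutativeRing)
open import Data.Bool.Base using (Bool; false; _∧_; _xor_)
open import Data.Bool.Properties using (xor-∧-commutativeRing)
open import Data.Fin.Base using (Fin; _<_)
open import Data.Fin.Permutation using (Permutation′; _⟨$⟩ʳ_)
open import Data.Fin.Properties using (_≟_)
open import Data.Fin.Subset using (Subset; _∈_; _∉_)
open import Data.List.Base using (List; []; _∷_)
open import Data.Nat.Base using (ℕ; zero; suc)
open import Data.Product using (Σ-syntax; ∃-syntax; ∃!; _×_; _,_)
open import Data.Vec.Base using (Vec; lookup; replicate; tabulate; zipWith)
open import Relation.Binary.PropositionalEquality.Core using (_≡_; _≢_)
open import Relation.Nullary.Decidable.Core using (does)

open import Algebra.Properties.Semiring.Sum
  (CommutativeRing.semiring xor-∧-commutativeRing) using (sum)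

------------------------------------------------------------------------
-- Linear algebra over GF(2): Bool with _xor_ as addition and _∧_ as
-- multiplication.

Vertex : ℕ → Set
Vertex n = Vec Bool n

infixl 6 _⊕_

_⊕_ : ∀ {n} → Vertex n → Vertex n → Vertex n
_⊕_ = zipWith _xor_

𝟎 : ∀ {n} → Vertex n
𝟎 = replicate _ false

e : ∀ {n} → Fin n → Vertex n
e i = tabulate λ j → does (i ≟ j)

Matrix : ℕ → Set
Matrix n = Fin n → Fin n → Bool

-- Matrices are functions, so they are compared entrywise.
infix 4 _≐_

_≐_ : ∀ {n} → Matrix n → Matrix n → Set
A ≐ B = ∀ i j → A i j ≡ B i j

infixl 7 _⊗_
infixr 7 _·_
infix  8 _ᵀ

_⊗_ : ∀ {n} → Matrix n → Matrix n → Matrix n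
(A ⊗ B) i j = sum λ k → A i k ∧ B k j

_·_ : ∀ {n} → Matrix n → Vertex n → Vertex n
A · v = tabulate λ i → sum λ j → A i j ∧ lookup v j

_ᵀ : ∀ {n} → Matrix n → Matrix n
(A ᵀ) i j = A j i

𝟏 : ∀ {n} → Matrix n
𝟏 i j = does (i ≟ j)

permutationMatrix : ∀ {n} → Permutation′ n → Matrix n
permutationMatrix π i j = does (π ⟨$⟩ʳ i ≟ j)

UpperTriangular : ∀ {n} → Matrix n → Set
UpperTriangular A = ∀ i j → j < i → A i j ≡ false

Invertible : ∀ {n} → Matrix n → Set
Invertible A = ∃[ B ] (A ⊗ B ≐ 𝟏) × (B ⊗ A ≐ 𝟏)

------------------------------------------------------------------------
-- Orientations of the hypercube

record Orientation (n : ℕ) : Set where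
  field
    outmap     : Vertex n → Vertex n
    consistent : ∀ v i → lookup (outmap v) i ≢ lookup (outmap (v ⊕ e i)) i

open Orientation public

-- The face through u with free coordinates I. Every non-empty face has
-- this form; I may be empty.
_∈Face⟨_,_⟩ : ∀ {n} → Vertex n → Vertex n → Subset n → Set
v ∈Face⟨ u , I ⟩ = ∀ i → i ∉ I → lookup v i ≡ lookup u i

-- No edge along a coordinate in I leaves v.
NoOutgoing : ∀ {n} → Orientation n → Subset n → Vertex n → Set
NoOutgoing o I v = ∀ i → i ∈ I → lookup (outmap o v) i ≡ false

IsUSO : ∀ {n} → Orientation n → Set
IsUSO o = ∀ u I → ∃! _≡_ λ v → v ∈Face⟨ u , I ⟩ × NoOutgoing o I v

MatoušekForm : ∀ {n} → Orientation n → Set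
MatoušekForm {n} o =
  Σ[ π ∈ Permutation′ n ] Σ[ A ∈ Matrix n ] Σ[ s ∈ Vertex n ]
    UpperTriangular A × Invertible A ×
    (∀ v → let P = permutationMatrix π in
           outmap o v ≡ (P ⊗ A ⊗ P ᵀ) · (v ⊕ s))

IsMatoušekUSO : ∀ {n} → Orientation n → Set
IsMatoušekUSO o = IsUSO o × MatoušekForm o

------------------------------------------------------------------------
-- Deterministic algorithms with a vertex evaluation oracle

data Action (n : ℕ) : Set where
  query  : Vertex n → Action n
  output : Vertex n → Action n

-- The queries made so far with their answers, most recent first.
History : ℕ → Set
History n = List (Vertex n × Vertex n)

-- The next action is a function of the dimension and of what the oracle
-- has revealed.
Algorithm : Set
Algorithm = ∀ n → History n → Action n

-- Outputs 𝒜 o h s k: from history h on, 𝒜 makes exactly k further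
-- queries to o and then outputs s. The vertex s need not have been queried.
data Outputs (𝒜 : Algorithm) {n : ℕ} (o : Orientation n) :
             History n → Vertex n → ℕ → Set where
  stop : ∀ {h s} → 𝒜 n h ≡ output s → Outputs 𝒜 o h s zero
  ask  : ∀ {h v s k} → 𝒜 n h ≡ query v →
         Outputs 𝒜 o ((v , outmap o v) ∷ h) s k → Outputs 𝒜 o h s (suc k)

FindsSinkWith : Algorithm → ∀ {n} → Orientation n → ℕ → Set
FindsSinkWith 𝒜 o k = ∃[ s ] Outputs 𝒜 o [] s k × outmap o s ≡ 𝟎

-- Correctness is required on Matoušek-type USOs only, so algorithms
-- specialised to that class are included.
SinkFinding : Algorithm → Set
SinkFinding 𝒜 =
  ∀ {n} (o : Orientation n) → IsMatoušekUSO o → ∃[ k ] FindsSinkWith 𝒜 o k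

{-# OPTIONS --safe #-}
module Submission where

-- An adversary answers the first query c with the all-ones outmap. It answers a
-- later query v ≠ c by fixing a coordinate p at which v and c differ: no other
-- coordinate influences p, and M (v ⊕ c) = e p, so the answer is all ones except
-- for a 0 at p. Projecting the cube along v ⊕ c onto the facet of the sink
-- identifies c with v, so the same situation recurs one dimension lower with v
-- in the role of c. Only queries after the first cost a dimension, so after n − 1
-- queries at least two free coordinates remain. An output s is then refuted by
-- fixing one more coordinate p: either s lies outside the facet of the sink, or
-- its outmap there is all ones.

open import Defs
open import Data.Bool.Base using (Bool; true; false; not; _∧_; _xor_)
import Data.Bool.Properties as Bool
open import Algebra.Bundles using (CommutativeRing)
open import Algebra.Properties.Semiring.Sum
  (CommutativeRing.semiring Bool.xor-∧-commutativeRing)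
  using (sum; sum-remove; sum-cong-≗; sum-replicate-zero; ∑-distrib-+; ∑-comm; *-distribˡ-sum; *-distribʳ-sum)
open import Data.Fin.Base using (Fin; zero; suc; punchIn; punchOut; fromℕ; _<_)
open import Data.Fin.Permutation using (Permutation′; _⟨$⟩ʳ_; insert; insert-punchIn)
import Data.Fin.Permutation as Permutation
open import Data.Fin.Properties
  using (_≟_; punchIn-punchOut; punchIn-injective; punchInᵢ≢i; punchIn-mono-≤; ≤fromℕ)
open import Data.Fin.Subset using (Subset; _∈_; _∉_)
open import Data.List.Base using ([]; _∷_)
open import Data.Nat.Base using (ℕ; zero; suc; z≤n; s≤s; _≤_)
open import Data.Nat.Properties using (<⇒≱; ≰⇒>; m≤n⇒m≤1+n; ≤-refl)
open import Data.Product.Base using (Σ-syntax; ∃-syntax; _×_; _,_; proj₁; proj₂)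
open import Data.Empty using (⊥)
open import Data.Vec.Base using (Vec; []; _∷_; lookup; replicate; tabulate; insertAt)
open import Data.Vec.Properties
  using (lookup∘tabulate; tabulate∘lookup; tabulate-cong; lookup-zipWith; lookup-replicate; ≡-dec
        ; insertAt-lookup; insertAt-punchIn; lookup⇒[]=; []=⇒lookup)
import Data.Vec.Functional as Vector
import Data.Vec.Functional.Properties as Vector
open import Function.Base using (_∘_)
open import Relation.Binary.PropositionalEquality
open import Relation.Nullary using (¬_; yes; no; contradiction)
open import Relation.Nullary.Decidable using (dec-true; dec-false)

private
  variable
    n k : ℕ

-- Vectors and indices split at one coordinate.

𝟏ⱽ : Vertex n
𝟏ⱽ = replicate _ true

punchIn-elim : ∀ {ℓ} {P : Fin (suc n) → Set ℓ} p → P p → (∀ j → P (punchIn p j)) → ∀ i → P i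
punchIn-elim {P = P} p Pp Pj i with p ≟ i
... | yes p≡i = subst P p≡i Pp
... | no  p≢i = subst P (punchIn-punchOut p≢i) (Pj (punchOut p≢i))

lookup-ext : ∀ {A : Set} {xs ys : Vec A n} → (∀ i → lookup xs i ≡ lookup ys i) → xs ≡ ys
lookup-ext {xs = xs} {ys} h =
  trans (sym (tabulate∘lookup xs)) (trans (tabulate-cong h) (tabulate∘lookup ys))

lookup-insertAt-ext : ∀ {A : Set} {xs : Vec A (suc n)} p {x ys} → lookup xs p ≡ x →
  (∀ j → lookup xs (punchIn p j) ≡ lookup ys j) → xs ≡ insertAt ys p x
lookup-insertAt-ext p {x} {ys} hp hj = lookup-ext (punchIn-elim p
  (trans hp (sym (insertAt-lookup ys p x)))
  (λ j → trans (hj j) (sym (insertAt-punchIn ys p x j))))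

-- Orientations built up one coordinate at a time.

rest : Fin (suc n) → Vertex (suc n) → Vertex n
rest p v = tabulate λ j → lookup v (punchIn p j)

-- The projection onto the facet where coordinate `p` equals `b`, along the direction that is 1 at
-- `p` and `w` elsewhere. The factor `lookup v p xor b` is 0 on that facet and 1 off it.
shear : Fin (suc n) → Vertex n → Bool → Vertex (suc n) → Vertex n
shear p w b v = tabulate λ j → lookup v (punchIn p j) xor ((lookup v p xor b) ∧ lookup w j)

-- In extend p w b F no other coordinate influences p, the sink has p-th
-- coordinate b, and off the facet of the sink F is applied after translating by w.
data Code : ℕ → Set where
  []     : Code zero
  extend : Fin (suc n) → Vertex n → Bool → Code n → Code (suc n)

⟦_⟧ : Code n → Vertex n → Vertex n
⟦ [] ⟧             v = []
⟦ extend p w b F ⟧ v = insertAt (⟦ F ⟧ (shear p w b v)) p (lookup v p xor b)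

module _ (p : Fin (suc n)) (w : Vertex n) (b : Bool) (F : Code n) where

  ⟦extend⟧-lookup : ∀ v → lookup (⟦ extend p w b F ⟧ v) p ≡ lookup v p xor b
  ⟦extend⟧-lookup v = insertAt-lookup (⟦ F ⟧ (shear p w b v)) p _

  ⟦extend⟧-punchIn : ∀ v j → lookup (⟦ extend p w b F ⟧ v) (punchIn p j) ≡ lookup (⟦ F ⟧ (shear p w b v)) j
  ⟦extend⟧-punchIn v j = insertAt-punchIn (⟦ F ⟧ (shear p w b v)) p _ j

-- Arithmetic in GF(2) and consistency of the outmaps.

xor-flip : ∀ x b → x xor b ≢ (x xor true) xor b
xor-flip false false ()
xor-flip false true ()
xor-flip true false ()
xor-flip true true ()

xor-cancelʳ : ∀ x y → (x xor y) xor y ≡ x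
xor-cancelʳ x y = trans (Bool.xor-assoc x y y)
  (trans (cong (x xor_) (Bool.xor-same y)) (Bool.xor-identityʳ x))

xor≡⇒≡xor : ∀ {x} y {z} → x xor y ≡ z → x ≡ z xor y
xor≡⇒≡xor {x} y h = trans (sym (xor-cancelʳ x y)) (cong (_xor y) h)

xor≡false⇒≡ : ∀ {x y} → x xor y ≡ false → x ≡ y
xor≡false⇒≡ {y = y} = xor≡⇒≡xor y

xor-swapʳ : ∀ x y z → (x xor y) xor z ≡ (x xor z) xor y
xor-swapʳ x y z = trans (Bool.xor-assoc x y z)
  (trans (cong (x xor_) (Bool.xor-comm y z)) (sym (Bool.xor-assoc x z y)))

𝟏-diagonal : ∀ (i : Fin n) → 𝟏 i i ≡ true
𝟏-diagonal i = dec-true (i ≟ i) refl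

𝟏-punchIn : ∀ p (j : Fin n) → 𝟏 p (punchIn p j) ≡ false
𝟏-punchIn p j = dec-false (p ≟ punchIn p j) (punchInᵢ≢i p j ∘ sym)

punchIn-𝟏 : ∀ p (i : Fin n) → 𝟏 (punchIn p i) p ≡ false
punchIn-𝟏 p i = dec-false (punchIn p i ≟ p) (punchInᵢ≢i p i)

punchIn-𝟏-punchIn : ∀ p (i j : Fin n) → 𝟏 (punchIn p i) (punchIn p j) ≡ 𝟏 i j
punchIn-𝟏-punchIn p i j with i ≟ j
... | yes refl = 𝟏-diagonal (punchIn p i)
... | no  i≢j  = dec-false (punchIn p i ≟ punchIn p j) (i≢j ∘ punchIn-injective p i j)

lookup-⊕-e : ∀ (v : Vertex n) i j → lookup (v ⊕ e i) j ≡ lookup v j xor 𝟏 i j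
lookup-⊕-e v i j = trans (lookup-zipWith _xor_ j v (e i))
  (cong (lookup v j xor_) (lookup∘tabulate (𝟏 i) j))

-- Flipping a coordinate other than `p` leaves the multiple of `w` unchanged, so edges in these
-- directions project to edges.
shear-⊕-e : ∀ p (w : Vertex n) b v i → shear p w b (v ⊕ e (punchIn p i)) ≡ shear p w b v ⊕ e i
shear-⊕-e p w b v i = lookup-ext λ j → begin
  lookup (shear p w b v⁺) j
    ≡⟨ lookup∘tabulate _ j ⟩
  lookup v⁺ (punchIn p j) xor ((lookup v⁺ p xor b) ∧ lookup w j)
    ≡⟨ cong₂ (λ x y → x xor ((y xor b) ∧ lookup w j))
         (trans (lookup-⊕-e v (punchIn p i) (punchIn p j))
                (cong (lookup v (punchIn p j) xor_) (punchIn-𝟏-punchIn p i j)))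
         (trans (lookup-⊕-e v (punchIn p i) p)
                (trans (cong (lookup v p xor_) (punchIn-𝟏 p i)) (Bool.xor-identityʳ (lookup v p)))) ⟩
  (lookup v (punchIn p j) xor 𝟏 i j) xor t j
    ≡⟨ xor-swapʳ (lookup v (punchIn p j)) (𝟏 i j) (t j) ⟩
  (lookup v (punchIn p j) xor t j) xor 𝟏 i j
    ≡⟨ cong (_xor 𝟏 i j) (lookup∘tabulate _ j) ⟨
  lookup (shear p w b v) j xor 𝟏 i j
    ≡⟨ lookup-⊕-e (shear p w b v) i j ⟨
  lookup (shear p w b v ⊕ e i) j ∎
  where
  open ≡-Reasoning
  v⁺ = v ⊕ e (punchIn p i)
  t : _ → Bool
  t j = (lookup v p xor b) ∧ lookup w j

⟦⟧-consistent : ∀ (F : Code n) v i → lookup (⟦ F ⟧ v) i ≢ lookup (⟦ F ⟧ (v ⊕ e i)) i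
⟦⟧-consistent (extend p w b F) v = punchIn-elim p at-p at-punchIn
  where
  at-p : lookup (⟦ extend p w b F ⟧ v) p ≢ lookup (⟦ extend p w b F ⟧ (v ⊕ e p)) p
  at-p h = xor-flip (lookup v p) b (begin
    lookup v p xor b
      ≡⟨ ⟦extend⟧-lookup p w b F v ⟨
    lookup (⟦ extend p w b F ⟧ v) p
      ≡⟨ h ⟩
    lookup (⟦ extend p w b F ⟧ (v ⊕ e p)) p
      ≡⟨ ⟦extend⟧-lookup p w b F (v ⊕ e p) ⟩
    lookup (v ⊕ e p) p xor b
      ≡⟨ cong (_xor b) (trans (lookup-⊕-e v p p) (cong (lookup v p xor_) (𝟏-diagonal p))) ⟩
    (lookup v p xor true) xor b ∎)
    where open ≡-Reasoning
  at-punchIn : ∀ j → lookup (⟦ extend p w b F ⟧ v) (punchIn p j) ≢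
                     lookup (⟦ extend p w b F ⟧ (v ⊕ e (punchIn p j))) (punchIn p j)
  at-punchIn j h = ⟦⟧-consistent F (shear p w b v) j (begin
    lookup (⟦ F ⟧ (shear p w b v)) j
      ≡⟨ ⟦extend⟧-punchIn p w b F v j ⟨
    lookup (⟦ extend p w b F ⟧ v) (punchIn p j)
      ≡⟨ h ⟩
    lookup (⟦ extend p w b F ⟧ (v ⊕ e (punchIn p j))) (punchIn p j)
      ≡⟨ ⟦extend⟧-punchIn p w b F (v ⊕ e (punchIn p j)) j ⟩
    lookup (⟦ F ⟧ (shear p w b (v ⊕ e (punchIn p j)))) j
      ≡⟨ cong (λ x → lookup (⟦ F ⟧ x) j) (shear-⊕-e p w b v j) ⟩
    lookup (⟦ F ⟧ (shear p w b v ⊕ e j)) j ∎)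
    where open ≡-Reasoning

orientation : Code n → Orientation n
orientation F = record { outmap = ⟦ F ⟧ ; consistent = ⟦⟧-consistent F }

-- Unique sinks of faces

private
  -- The sink of a face has its coordinate `p` forced: to `b` if `p` is free, to that of `u`
  -- otherwise. Packing both cases into one `β` spares the proof below a case split.
  sink-coordinate : ∀ (u : Vertex n) (I : Subset n) p b → Σ[ β ∈ Bool ]
    (p ∉ I → β ≡ lookup u p) × (p ∈ I → β xor b ≡ false) ×
    (∀ x → (p ∉ I → x ≡ lookup u p) → (p ∈ I → x xor b ≡ false) → x ≡ β)
  sink-coordinate u I p b with lookup I p in eq
  ... | true  = b , (λ p∉I → contradiction p∈I p∉I) , (λ _ → Bool.xor-same b) ,
                (λ x _ h → xor≡false⇒≡ (h p∈I))
    where p∈I = lookup⇒[]= p I eq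
  ... | false = lookup u p , (λ _ → refl) , (λ p∈I → contradiction p∈I p∉I) , (λ x h _ → h p∉I)
    where
    p∉I : p ∉ I
    p∉I p∈I = contradiction (trans (sym ([]=⇒lookup p∈I)) eq) λ ()

-- Once coordinate `p` is pinned to `β`, the shear is a translation of the other coordinates. It
-- carries faces to faces, so the unique sink comes from one dimension lower.
⟦⟧-isUSO : ∀ (F : Code n) → IsUSO (orientation F)
⟦⟧-isUSO [] u I = [] , ((λ ()) , (λ ())) , λ { {[]} _ → refl }
⟦⟧-isUSO {suc n} (extend p w b F) u I with sink-coordinate u I p b
... | β , β-face , β-sink , β-unique
  with x , (x-face , x-sink) , x-unique ←
    ⟦⟧-isUSO F (tabulate λ j → lookup u (punchIn p j) xor ((β xor b) ∧ lookup w j)) (rest p I) =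
  y , (punchIn-elim p y-face-p y-face , punchIn-elim p y-sink-p y-sink) , y-unique
  where
  open ≡-Reasoning
  I′ : Subset n
  I′ = rest p I

  ∈I′⇒ : ∀ {j} → j ∈ I′ → punchIn p j ∈ I
  ∈I′⇒ {j} j∈I′ = lookup⇒[]= _ I (trans (sym (lookup∘tabulate _ j)) ([]=⇒lookup j∈I′))

  ⇒∈I′ : ∀ {j} → punchIn p j ∈ I → j ∈ I′
  ⇒∈I′ {j} j∈I = lookup⇒[]= j I′ (trans (lookup∘tabulate _ j) ([]=⇒lookup j∈I))

  t : Fin n → Bool
  t j = (β xor b) ∧ lookup w j

  -- Translation by `t` is its own inverse, so it also pulls the sink `x` back.
  z : Vertex n
  z = tabulate λ j → lookup x j xor t j

  y : Vertex (suc n)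
  y = insertAt z p β

  y-p : lookup y p ≡ β
  y-p = insertAt-lookup z p β

  y-punchIn : ∀ j → lookup y (punchIn p j) ≡ lookup x j xor t j
  y-punchIn j = trans (insertAt-punchIn z p β j) (lookup∘tabulate _ j)

  shear-y : shear p w b y ≡ x
  shear-y = lookup-ext λ j → begin
    lookup (shear p w b y) j
      ≡⟨ lookup∘tabulate _ j ⟩
    lookup y (punchIn p j) xor ((lookup y p xor b) ∧ lookup w j)
      ≡⟨ cong₂ (λ a c → a xor ((c xor b) ∧ lookup w j)) (y-punchIn j) y-p ⟩
    (lookup x j xor t j) xor t j
      ≡⟨ xor-cancelʳ (lookup x j) (t j) ⟩
    lookup x j ∎

  y-face-p : p ∉ I → lookup y p ≡ lookup u p
  y-face-p p∉I = trans y-p (β-face p∉I)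

  y-face : ∀ j → punchIn p j ∉ I → lookup y (punchIn p j) ≡ lookup u (punchIn p j)
  y-face j j∉I = begin
    lookup y (punchIn p j)                     ≡⟨ y-punchIn j ⟩
    lookup x j xor t j                         ≡⟨ cong (_xor t j) (x-face j (j∉I ∘ ∈I′⇒)) ⟩
    _                                          ≡⟨ cong (_xor t j) (lookup∘tabulate _ j) ⟩
    (lookup u (punchIn p j) xor t j) xor t j   ≡⟨ xor-cancelʳ _ (t j) ⟩
    lookup u (punchIn p j)                     ∎

  y-sink-p : p ∈ I → lookup (⟦ extend p w b F ⟧ y) p ≡ false
  y-sink-p p∈I = trans (⟦extend⟧-lookup p w b F y) (trans (cong (_xor b) y-p) (β-sink p∈I))

  y-sink : ∀ j → punchIn p j ∈ I → lookup (⟦ extend p w b F ⟧ y) (punchIn p j) ≡ false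
  y-sink j j∈I = trans (⟦extend⟧-punchIn p w b F y j)
    (trans (cong (λ a → lookup (⟦ F ⟧ a) j) shear-y) (x-sink j (⇒∈I′ j∈I)))

  y-unique : ∀ {v} → v ∈Face⟨ u , I ⟩ × NoOutgoing (orientation (extend p w b F)) I v → y ≡ v
  y-unique {v} (v-face , v-sink) = sym (lookup-insertAt-ext p v-p v-punchIn)
    where
    v-p : lookup v p ≡ β
    v-p = β-unique _ (v-face p) (λ p∈I → trans (sym (⟦extend⟧-lookup p w b F v)) (v-sink p p∈I))

    lookup-shear-v : ∀ j → lookup (shear p w b v) j ≡ lookup v (punchIn p j) xor t j
    lookup-shear-v j = trans (lookup∘tabulate _ j)
      (cong (λ c → lookup v (punchIn p j) xor ((c xor b) ∧ lookup w j)) v-p)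

    x≡shear : x ≡ shear p w b v
    x≡shear = x-unique
      ( (λ j j∉I′ → trans (lookup-shear-v j)
          (trans (cong (_xor t j) (v-face _ (j∉I′ ∘ ⇒∈I′))) (sym (lookup∘tabulate _ j))))
      , (λ j j∈I′ → trans (sym (⟦extend⟧-punchIn p w b F v j)) (v-sink _ (∈I′⇒ j∈I′))))

    v-punchIn : ∀ j → lookup v (punchIn p j) ≡ lookup z j
    v-punchIn j = begin
      lookup v (punchIn p j)                    ≡⟨ xor≡⇒≡xor (t j) (sym (lookup-shear-v j)) ⟩
      lookup (shear p w b v) j xor t j          ≡⟨ cong (λ a → lookup a j xor t j) x≡shear ⟨
      lookup x j xor t j                        ≡⟨ lookup∘tabulate _ j ⟨
      lookup z j                                ∎

-- The Matoušek form

-- With index `p` moved to the end, this is the block matrix with rows (A, a) and (0, 1).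
border : Fin (suc n) → (Fin n → Bool) → Matrix n → Matrix (suc n)
border p a A = Vector.insertAt (λ i → Vector.insertAt (A i) p (a i)) p
                               (Vector.insertAt (λ _ → false) p true)

module _ (p : Fin (suc n)) (a : Fin n → Bool) (A : Matrix n) where

  border-pp : border p a A p p ≡ true
  border-pp = trans (cong-app (Vector.insertAt-lookup _ p _) p) (Vector.insertAt-lookup _ p true)

  border-pj : ∀ j → border p a A p (punchIn p j) ≡ false
  border-pj j = trans (cong-app (Vector.insertAt-lookup _ p _) _) (Vector.insertAt-punchIn _ p true j)

  border-ip : ∀ i → border p a A (punchIn p i) p ≡ a i
  border-ip i = trans (cong-app (Vector.insertAt-punchIn _ p _ i) p) (Vector.insertAt-lookup _ p _)

  border-ij : ∀ i j → border p a A (punchIn p i) (punchIn p j) ≡ A i j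
  border-ij i j = trans (cong-app (Vector.insertAt-punchIn _ p _ i) _) (Vector.insertAt-punchIn _ p _ j)

module _ (p : Fin (suc n)) {a c : Fin n → Bool} {A C : Matrix n} where
  open ≡-Reasoning

  private
    row : ∀ i j → (border p a A ⊗ border p c C) i j ≡
      (border p a A i p ∧ border p c C p j) xor
      sum (λ k → border p a A i (punchIn p k) ∧ border p c C (punchIn p k) j)
    row i j = sum-remove {i = p} (λ k → border p a A i k ∧ border p c C k j)

    sum-false : ∀ {f : Fin n → Bool} → (∀ k → f k ≡ false) → sum f ≡ false
    sum-false h = trans (sum-cong-≗ h) (sum-replicate-zero n)

  -- In block form the product has rows (AC, a ⊕ Ac) and (0, 1).
  border-inverse : (∀ i → a i xor sum (λ k → A i k ∧ c k) ≡ false) → A ⊗ C ≐ 𝟏 →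
                   border p a A ⊗ border p c C ≐ 𝟏
  border-inverse ac≡0 AC≐𝟏 = punchIn-elim p
    (punchIn-elim p
      (begin
        _ ≡⟨ row p p ⟩
        _ ≡⟨ cong₂ _xor_ (cong₂ _∧_ (border-pp p a A) (border-pp p c C))
                         (sum-false λ k → cong (_∧ _) (border-pj p a A k)) ⟩
        true ≡⟨ 𝟏-diagonal p ⟨
        𝟏 p p ∎)
      (λ j → begin
        _ ≡⟨ row p (punchIn p j) ⟩
        _ ≡⟨ cong₂ _xor_ (cong₂ _∧_ (border-pp p a A) (border-pj p c C j))
                         (sum-false λ k → cong (_∧ _) (border-pj p a A k)) ⟩
        false ≡⟨ 𝟏-punchIn p j ⟨
        𝟏 p (punchIn p j) ∎))
    (λ i → punchIn-elim p
      (begin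
        _ ≡⟨ row (punchIn p i) p ⟩
        _ ≡⟨ cong₂ _xor_ (trans (cong₂ _∧_ (border-ip p a A i) (border-pp p c C)) (Bool.∧-identityʳ _))
                         (sum-cong-≗ λ k → cong₂ _∧_ (border-ij p a A i k) (border-ip p c C k)) ⟩
        _ ≡⟨ ac≡0 i ⟩
        false ≡⟨ punchIn-𝟏 p i ⟨
        𝟏 (punchIn p i) p ∎)
      (λ j → begin
        _ ≡⟨ row (punchIn p i) (punchIn p j) ⟩
        _ ≡⟨ cong₂ _xor_ (trans (cong₂ _∧_ (border-ip p a A i) (border-pj p c C j)) (Bool.∧-zeroʳ _))
                         (sum-cong-≗ λ k → cong₂ _∧_ (border-ij p a A i k) (border-ij p c C k j)) ⟩
        _ ≡⟨ AC≐𝟏 i j ⟩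
        𝟏 i j ≡⟨ punchIn-𝟏-punchIn p i j ⟨
        𝟏 (punchIn p i) (punchIn p j) ∎))

sum-𝟏 : ∀ (i : Fin n) (f : Fin n → Bool) → sum (λ k → 𝟏 i k ∧ f k) ≡ f i
sum-𝟏 {suc n} i f = begin
  sum (λ k → 𝟏 i k ∧ f k)
    ≡⟨ sum-remove {i = i} (λ k → 𝟏 i k ∧ f k) ⟩
  (𝟏 i i ∧ f i) xor sum (λ k → 𝟏 i (punchIn i k) ∧ f (punchIn i k))
    ≡⟨ cong₂ _xor_ (cong (_∧ f i) (𝟏-diagonal i))
         (trans (sum-cong-≗ λ k → cong (_∧ f (punchIn i k)) (𝟏-punchIn i k)) (sum-replicate-zero n)) ⟩
  f i xor false
    ≡⟨ Bool.xor-identityʳ (f i) ⟩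
  f i ∎
  where open ≡-Reasoning

⊗-action : ∀ (A B : Matrix n) (x : Fin n → Bool) i →
  sum (λ k → A i k ∧ sum (λ l → B k l ∧ x l)) ≡ sum (λ l → (A ⊗ B) i l ∧ x l)
⊗-action A B x i = begin
  sum (λ k → A i k ∧ sum (λ l → B k l ∧ x l))
    ≡⟨ sum-cong-≗ (λ k → *-distribˡ-sum (A i k) (λ l → B k l ∧ x l)) ⟩
  sum (λ k → sum (λ l → A i k ∧ (B k l ∧ x l)))
    ≡⟨ ∑-comm (λ k l → A i k ∧ (B k l ∧ x l)) ⟩
  sum (λ l → sum (λ k → A i k ∧ (B k l ∧ x l)))
    ≡⟨ sum-cong-≗ (λ l → sum-cong-≗ λ k → Bool.∧-assoc (A i k) (B k l) (x l)) ⟨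
  sum (λ l → sum (λ k → (A i k ∧ B k l) ∧ x l))
    ≡⟨ sum-cong-≗ (λ l → *-distribʳ-sum (x l) (λ k → A i k ∧ B k l)) ⟨
  sum (λ l → (A ⊗ B) i l ∧ x l) ∎
  where open ≡-Reasoning

-- The inverse carries the column Ba, with no sign over GF(2): the off-diagonal blocks of the two
-- products are a ⊕ ABa and Ba ⊕ Ba, both zero.
border-invertible : ∀ p (a : Fin n → Bool) {A} → Invertible A → Invertible (border p a A)
border-invertible {n} p a {A} (B , AB≐𝟏 , BA≐𝟏) = border p c B ,
  border-inverse p ac≡0 AB≐𝟏 , border-inverse p (λ i → Bool.xor-same (c i)) BA≐𝟏
  where
  open ≡-Reasoning
  c : Fin n → Bool
  c k = sum λ l → B k l ∧ a l
  ac≡0 : ∀ i → a i xor sum (λ k → A i k ∧ c k) ≡ false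
  ac≡0 i = begin
    a i xor sum (λ k → A i k ∧ c k)         ≡⟨ cong (a i xor_) (⊗-action A B a i) ⟩
    a i xor sum (λ l → (A ⊗ B) i l ∧ a l)   ≡⟨ cong (a i xor_) (sum-cong-≗ λ l → cong (_∧ a l) (AB≐𝟏 i l)) ⟩
    a i xor sum (λ l → 𝟏 i l ∧ a l)         ≡⟨ cong (a i xor_) (sum-𝟏 i a) ⟩
    a i xor a i                             ≡⟨ Bool.xor-same (a i) ⟩
    false                                   ∎

punchIn-cancel-< : ∀ p (j i : Fin n) → punchIn p j < punchIn p i → j < i
punchIn-cancel-< p j i h = ≰⇒> λ i≤j → <⇒≱ h (punchIn-mono-≤ p i j i≤j)

-- The row of the new index is zero off the diagonal, so this index must come last; the column `a`
-- then lies above the diagonal.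
border-upperTriangular : ∀ (a : Fin n → Bool) {A} → UpperTriangular A →
                         UpperTriangular (border (fromℕ n) a A)
border-upperTriangular {n} a {A} upper = punchIn-elim L
  (punchIn-elim L (λ L<L → contradiction ≤-refl (<⇒≱ L<L)) (λ j _ → border-pj L a A j))
  (λ i → punchIn-elim L
    (λ L<i → contradiction (≤fromℕ (punchIn L i)) (<⇒≱ L<i))
    (λ j h → trans (border-ij L a A i j) (upper i j (punchIn-cancel-< L j i h))))
  where L = fromℕ n

insert-at : ∀ i j (π : Permutation′ n) → insert i j π ⟨$⟩ʳ i ≡ j
insert-at i j π with i ≟ i
... | yes _  = refl
... | no i≢i = contradiction refl i≢i

-- Each row of a permutation matrix has a single 1, so both sums collapse to one term.
permuted-entry : ∀ (π : Permutation′ n) (A : Matrix n) i j → let P = permutationMatrix π in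
                 (P ⊗ A ⊗ P ᵀ) i j ≡ A (π ⟨$⟩ʳ i) (π ⟨$⟩ʳ j)
permuted-entry π A i j = begin
  sum (λ l → (P ⊗ A) i l ∧ P j l)
    ≡⟨ sum-cong-≗ (λ l → trans (Bool.∧-comm _ (P j l)) (cong (P j l ∧_) (sum-𝟏 (π ⟨$⟩ʳ i) (λ k → A k l)))) ⟩
  sum (λ l → P j l ∧ A (π ⟨$⟩ʳ i) l)
    ≡⟨ sum-𝟏 (π ⟨$⟩ʳ j) (A (π ⟨$⟩ʳ i)) ⟩
  A (π ⟨$⟩ʳ i) (π ⟨$⟩ʳ j) ∎
  where
  open ≡-Reasoning
  P = permutationMatrix π

-- The Matoušek form stated entrywise, without products by permutation matrices, so that the
-- induction only has to border a matrix.
record TriangularForm (F : Code n) : Set where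
  field
    π               : Permutation′ n
    A               : Matrix n
    s               : Vertex n
    upperTriangular : UpperTriangular A
    invertible      : Invertible A

  entry : Matrix n
  entry i j = A (π ⟨$⟩ʳ i) (π ⟨$⟩ʳ j)

  field
    lookup-⟦⟧ : ∀ v i → lookup (⟦ F ⟧ v) i ≡ sum λ j → entry i j ∧ (lookup v j xor lookup s j)

triangularForm : ∀ (F : Code n) → TriangularForm F
triangularForm [] = record
  { π = Permutation.id ; A = λ () ; s = []
  ; upperTriangular = λ () ; invertible = (λ ()) , (λ ()) , (λ ())
  ; lookup-⟦⟧ = λ _ () }
triangularForm {suc n} (extend p w b F) = record
  { π = π⁺ ; A = A⁺ ; s = s⁺
  ; upperTriangular = border-upperTriangular a upperTriangular
  ; invertible = border-invertible L a invertible
  ; lookup-⟦⟧ = λ v → punchIn-elim p (at-p v) (at-punchIn v) }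
  where
  open TriangularForm (triangularForm F)
  open ≡-Reasoning
  L = fromℕ n
  π⁺ = insert p L π
  s⁺ = insertAt s p b

  -- By linearity, translating by `w` before applying `F` adds the image of `w` under the matrix of
  -- `F`. This image, indexed in triangular order, is the new column.
  a : Fin n → Bool
  a k = sum λ j → A k (π ⟨$⟩ʳ j) ∧ lookup w j

  A⁺ : Matrix (suc n)
  A⁺ = border L a A

  entry⁺ : Matrix (suc n)
  entry⁺ i j = A⁺ (π⁺ ⟨$⟩ʳ i) (π⁺ ⟨$⟩ʳ j)

  entry⁺-pp : entry⁺ p p ≡ true
  entry⁺-pp = trans (cong₂ A⁺ (insert-at p L π) (insert-at p L π)) (border-pp L a A)

  entry⁺-pj : ∀ j → entry⁺ p (punchIn p j) ≡ false
  entry⁺-pj j = trans (cong₂ A⁺ (insert-at p L π) (insert-punchIn p L π j)) (border-pj L a A _)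

  entry⁺-ip : ∀ i → entry⁺ (punchIn p i) p ≡ a (π ⟨$⟩ʳ i)
  entry⁺-ip i = trans (cong₂ A⁺ (insert-punchIn p L π i) (insert-at p L π)) (border-ip L a A _)

  entry⁺-ij : ∀ i j → entry⁺ (punchIn p i) (punchIn p j) ≡ entry i j
  entry⁺-ij i j = trans (cong₂ A⁺ (insert-punchIn p L π i) (insert-punchIn p L π j)) (border-ij L a A _ _)

  module _ (v : Vertex (suc n)) where
    t : Bool
    t = lookup v p xor b

    d : Fin n → Bool
    d j = lookup v (punchIn p j) xor lookup s j

    d⁺ : Fin (suc n) → Bool
    d⁺ j = lookup v j xor lookup s⁺ j

    d⁺-p : d⁺ p ≡ t
    d⁺-p = cong (lookup v p xor_) (insertAt-lookup s p b)

    d⁺-punchIn : ∀ j → d⁺ (punchIn p j) ≡ d j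
    d⁺-punchIn j = cong (lookup v (punchIn p j) xor_) (insertAt-punchIn s p b j)

    at-p : lookup (⟦ extend p w b F ⟧ v) p ≡ sum (λ j → entry⁺ p j ∧ d⁺ j)
    at-p = sym (begin
      sum (λ j → entry⁺ p j ∧ d⁺ j)
        ≡⟨ sum-remove {i = p} (λ j → entry⁺ p j ∧ d⁺ j) ⟩
      (entry⁺ p p ∧ d⁺ p) xor sum (λ j → entry⁺ p (punchIn p j) ∧ d⁺ (punchIn p j))
        ≡⟨ cong₂ _xor_ (cong₂ _∧_ entry⁺-pp d⁺-p)
             (trans (sum-cong-≗ λ j → cong (_∧ d⁺ (punchIn p j)) (entry⁺-pj j)) (sum-replicate-zero n)) ⟩
      t xor false
        ≡⟨ Bool.xor-identityʳ t ⟩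
      t
        ≡⟨ ⟦extend⟧-lookup p w b F v ⟨
      lookup (⟦ extend p w b F ⟧ v) p ∎)

    at-punchIn : ∀ i → lookup (⟦ extend p w b F ⟧ v) (punchIn p i) ≡ sum (λ j → entry⁺ (punchIn p i) j ∧ d⁺ j)
    at-punchIn i = begin
      lookup (⟦ extend p w b F ⟧ v) (punchIn p i)
        ≡⟨ ⟦extend⟧-punchIn p w b F v i ⟩
      lookup (⟦ F ⟧ (shear p w b v)) i
        ≡⟨ lookup-⟦⟧ (shear p w b v) i ⟩
      sum (λ j → entry i j ∧ (lookup (shear p w b v) j xor lookup s j))
        ≡⟨ sum-cong-≗ term ⟩
      sum (λ j → ((entry i j ∧ lookup w j) ∧ t) xor (entry i j ∧ d j))
        ≡⟨ ∑-distrib-+ (λ j → (entry i j ∧ lookup w j) ∧ t) (λ j → entry i j ∧ d j) ⟩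
      sum (λ j → (entry i j ∧ lookup w j) ∧ t) xor sum (λ j → entry i j ∧ d j)
        ≡⟨ cong (_xor sum (λ j → entry i j ∧ d j)) (*-distribʳ-sum t (λ j → entry i j ∧ lookup w j)) ⟨
      (a (π ⟨$⟩ʳ i) ∧ t) xor sum (λ j → entry i j ∧ d j)
        ≡⟨ cong₂ _xor_ (cong₂ _∧_ (entry⁺-ip i) d⁺-p)
             (sum-cong-≗ λ j → cong₂ _∧_ (entry⁺-ij i j) (d⁺-punchIn j)) ⟨
      (entry⁺ (punchIn p i) p ∧ d⁺ p) xor sum (λ j → entry⁺ (punchIn p i) (punchIn p j) ∧ d⁺ (punchIn p j))
        ≡⟨ sum-remove {i = p} (λ j → entry⁺ (punchIn p i) j ∧ d⁺ j) ⟨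
      sum (λ j → entry⁺ (punchIn p i) j ∧ d⁺ j) ∎
      where
      term : ∀ j → entry i j ∧ (lookup (shear p w b v) j xor lookup s j) ≡
                   ((entry i j ∧ lookup w j) ∧ t) xor (entry i j ∧ d j)
      term j = begin
        m ∧ (lookup (shear p w b v) j xor σ)
          ≡⟨ cong (λ z → m ∧ (z xor σ)) (lookup∘tabulate _ j) ⟩
        m ∧ ((x xor (t ∧ ω)) xor σ)
          ≡⟨ cong (m ∧_) (trans (xor-swapʳ x (t ∧ ω) σ) (Bool.xor-comm (x xor σ) (t ∧ ω))) ⟩
        m ∧ ((t ∧ ω) xor d j)
          ≡⟨ Bool.∧-distribˡ-xor m (t ∧ ω) (d j) ⟩
        (m ∧ (t ∧ ω)) xor (m ∧ d j)
          ≡⟨ cong (_xor (m ∧ d j)) (trans (cong (m ∧_) (Bool.∧-comm t ω)) (sym (Bool.∧-assoc m ω t))) ⟩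
        ((m ∧ ω) ∧ t) xor (m ∧ d j) ∎
        where
        m = entry i j
        σ = lookup s j
        ω = lookup w j
        x = lookup v (punchIn p j)

⟦⟧-isMatoušekUSO : ∀ (F : Code n) → IsMatoušekUSO (orientation F)
⟦⟧-isMatoušekUSO F = ⟦⟧-isUSO F , π , A , s , upperTriangular , invertible , λ v → lookup-ext λ i → begin
  lookup (⟦ F ⟧ v) i
    ≡⟨ lookup-⟦⟧ v i ⟩
  sum (λ j → entry i j ∧ (lookup v j xor lookup s j))
    ≡⟨ sum-cong-≗ (λ j → cong₂ _∧_ (permuted-entry π A i j) (lookup-zipWith _xor_ j v s)) ⟨
  sum (λ j → (permutationMatrix π ⊗ A ⊗ permutationMatrix π ᵀ) i j ∧ lookup (v ⊕ s) j)
    ≡⟨ lookup∘tabulate _ i ⟨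
  lookup ((permutationMatrix π ⊗ A ⊗ permutationMatrix π ᵀ) · (v ⊕ s)) i ∎
  where
  open TriangularForm (triangularForm F)
  open ≡-Reasoning

-- The adversary

-- A decision tree with at most `k` probes on each branch; unlike a function of histories, it can be
-- transported to a lower dimension. `cutoff` marks an exhausted budget and so yields no output.
data Strategy (n : ℕ) : ℕ → Set where
  halt   : Vertex n → Strategy n k
  cutoff : Strategy n k
  probe  : Vertex n → (Vertex n → Strategy n k) → Strategy n (suc k)

Yields : Strategy n k → (Vertex n → Vertex n) → Vertex n → Set
Yields (halt s′)   o s = s ≡ s′
Yields cutoff      o s = ⊥
Yields (probe v f) o s = Yields (f (o v)) o s

truncate : (History n → Action n) → ∀ k → History n → Strategy n k
truncate next k h with next h
truncate next k       h | output s = halt s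
truncate next zero    h | query v  = cutoff
truncate next (suc k) h | query v  = probe v λ y → truncate next k ((v , y) ∷ h)

truncate-yields : ∀ 𝒜 (o : Orientation n) {h s l} → l ≤ k → Outputs 𝒜 o h s l →
                  Yields (truncate (𝒜 n) k h) (outmap o) s
truncate-yields {n} 𝒜 o {h} l≤k (stop eq) with output _ ← 𝒜 n h | refl ← eq = refl
truncate-yields {n} {suc k} 𝒜 o {h} (s≤s l≤k) (ask eq run) with query _ ← 𝒜 n h | refl ← eq =
  truncate-yields 𝒜 o l≤k run

-- Simulates a strategy for the extended orientation by probing `F` alone: coordinate `p` of each
-- answer is computable from the probe without the oracle.
shearStrategy : Fin (suc n) → Vertex n → Bool → Strategy (suc n) k → Strategy n k
shearStrategy p w b (halt s)    = halt (shear p w b s)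
shearStrategy p w b cutoff      = cutoff
shearStrategy p w b (probe v f) = probe (shear p w b v)
  λ y → shearStrategy p w b (f (insertAt y p (lookup v p xor b)))

shearStrategy-yields : ∀ p w b (F : Code n) (T : Strategy (suc n) k) s →
  Yields T ⟦ extend p w b F ⟧ s → Yields (shearStrategy p w b T) ⟦ F ⟧ (shear p w b s)
shearStrategy-yields p w b F (halt _)    s refl = refl
shearStrategy-yields p w b F (probe v f) s run  = shearStrategy-yields p w b F (f _) s run

Sink : Code n → Vertex n → Set
Sink F s = ⟦ F ⟧ s ≡ 𝟎

-- Carries a refutation found one dimension lower back up: if the projected vertex is no sink of
-- `F`, then `s` is no sink of the extension.
sink-shear : ∀ p w b (F : Code n) s → Sink (extend p w b F) s → Sink F (shear p w b s)
sink-shear p w b F s h = lookup-ext λ j → begin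
  lookup (⟦ F ⟧ (shear p w b s)) j                 ≡⟨ ⟦extend⟧-punchIn p w b F s j ⟨
  lookup (⟦ extend p w b F ⟧ s) (punchIn p j)      ≡⟨ cong (λ x → lookup x (punchIn p j)) h ⟩
  lookup 𝟎 (punchIn p j)                           ≡⟨ lookup-replicate (punchIn p j) false ⟩
  false                                            ≡⟨ lookup-replicate j false ⟨
  lookup 𝟎 j                                       ∎
  where open ≡-Reasoning

shear-trivial : ∀ p (w : Vertex n) b v → lookup v p xor b ≡ false → shear p w b v ≡ rest p v
shear-trivial p w b v t≡0 = tabulate-cong λ j →
  trans (cong (λ t → lookup v (punchIn p j) xor (t ∧ lookup w j)) t≡0) (Bool.xor-identityʳ _)

-- Coordinate p influences the others precisely so that c is projected onto d.
module _ (p : Fin (suc n)) (c : Vertex (suc n)) (d : Vertex n) where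

  private
    w = rest p c ⊕ d
    -- This places `c` off the facet of the sink, so its outmap is 1 at `p` and the translation by
    -- `w` applies to it.
    b = not (lookup c p)

  steer : Code n → Code (suc n)
  steer = extend p w b

  shear-steer : shear p w b c ≡ d
  shear-steer = lookup-ext λ j → begin
    lookup (shear p w b c) j
      ≡⟨ lookup∘tabulate _ j ⟩
    lookup c (punchIn p j) xor ((lookup c p xor b) ∧ lookup w j)
      ≡⟨ cong₂ (λ t x → lookup c (punchIn p j) xor (t ∧ x)) (Bool.xor-inverseʳ (lookup c p))
           (trans (lookup-zipWith _xor_ j (rest p c) d) (cong (_xor lookup d j) (lookup∘tabulate _ j))) ⟩
    lookup c (punchIn p j) xor (lookup c (punchIn p j) xor lookup d j)
      ≡⟨ Bool.xor-assoc (lookup c (punchIn p j)) _ _ ⟨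
    (lookup c (punchIn p j) xor lookup c (punchIn p j)) xor lookup d j
      ≡⟨ cong (_xor lookup d j) (Bool.xor-same (lookup c (punchIn p j))) ⟩
    lookup d j ∎
    where open ≡-Reasoning

  steer-𝟏 : ∀ F → ⟦ F ⟧ d ≡ 𝟏ⱽ → ⟦ steer F ⟧ c ≡ 𝟏ⱽ
  steer-𝟏 F Fd≡𝟏 = lookup-ext (punchIn-elim p
    (trans (⟦extend⟧-lookup p w b F c) (trans (Bool.xor-inverseʳ (lookup c p)) (sym (lookup-replicate p true))))
    λ j → begin
      lookup (⟦ steer F ⟧ c) (punchIn p j)  ≡⟨ ⟦extend⟧-punchIn p w b F c j ⟩
      lookup (⟦ F ⟧ _) j                    ≡⟨ cong (λ x → lookup (⟦ F ⟧ x) j) shear-steer ⟩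
      lookup (⟦ F ⟧ d) j                    ≡⟨ cong (λ x → lookup x j) Fd≡𝟏 ⟩
      lookup 𝟏ⱽ j                           ≡⟨ lookup-replicate j true ⟩
      true                                  ≡⟨ lookup-replicate (punchIn p j) true ⟨
      lookup 𝟏ⱽ (punchIn p j)               ∎)
    where open ≡-Reasoning

-- Since `d` is the tail of `c`, all translations vanish; the result is the uniform orientation
-- whose sink is antipodal to `c`.
𝟏-at : ∀ (c : Vertex n) → Σ[ F ∈ Code n ] ⟦ F ⟧ c ≡ 𝟏ⱽ
𝟏-at []        = [] , refl
𝟏-at c@(_ ∷ d) = let F , Fd≡𝟏 = 𝟏-at d in steer zero c d F , steer-𝟏 zero c d F Fd≡𝟏

differ : ∀ {v c : Vertex n} → v ≢ c → ∃[ p ] lookup v p ≢ lookup c p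
differ {v = []}    {[]}    v≢c = contradiction refl v≢c
differ {v = x ∷ v} {y ∷ c} v≢c with x Bool.≟ y
... | no  x≢y  = zero , x≢y
... | yes refl = let p , h = differ (v≢c ∘ cong (x ∷_)) in suc p , h

≢⇒xor-not : ∀ {x y} → x ≢ y → x xor not y ≡ false
≢⇒xor-not {false} {false} h = contradiction refl h
≢⇒xor-not {false} {true}  h = refl
≢⇒xor-not {true}  {false} h = refl
≢⇒xor-not {true}  {true}  h = contradiction refl h

-- The adversary's induction over decision trees.

Defeats : Vertex n → Strategy n k → Code n → Set
Defeats c T F = ⟦ F ⟧ c ≡ 𝟏ⱽ × (∀ s → Yields T ⟦ F ⟧ s → ¬ Sink F s)

-- Here `c` is the vertex whose all-ones answer is already revealed, and `T` is the rest of the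
-- algorithm. Each probe uses up one unit of budget and at most one dimension, so `k ≤ m` keeps two
-- dimensions in reserve for the final output.
defeat : ∀ {m} (c : Vertex (suc (suc m))) → k ≤ m → (T : Strategy (suc (suc m)) k) →
         Σ[ F ∈ Code (suc (suc m)) ] Defeats c T F
defeat c k≤m cutoff = let F , Fc≡𝟏 = 𝟏-at c in F , Fc≡𝟏 , λ _ ()
defeat c k≤m (halt s) = steer zero c d F , steer-𝟏 zero c d F Fd≡𝟏 , λ { _ refl → not-sink }
  where
  d = rest zero s
  F = proj₁ (𝟏-at d)
  Fd≡𝟏 = proj₂ (𝟏-at d)
  w = rest zero c ⊕ d
  b = not (lookup c zero)
  t≡0 : Sink (steer zero c d F) s → lookup s zero xor b ≡ false
  t≡0 sink = trans (sym (⟦extend⟧-lookup zero w b F s)) (cong (λ x → lookup x zero) sink)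
  Fd≡𝟎 : Sink (steer zero c d F) s → ⟦ F ⟧ d ≡ 𝟎
  Fd≡𝟎 sink = trans (cong ⟦ F ⟧ (sym (shear-trivial zero w b s (t≡0 sink)))) (sink-shear zero w b F s sink)
  not-sink : ¬ Sink (steer zero c d F) s
  -- The facet still has dimension at least one, so the all-ones vector and zero differ in its first
  -- coordinate.
  not-sink sink with () ← trans (sym Fd≡𝟏) (Fd≡𝟎 sink)
defeat c k≤m (probe v f) with ≡-dec Bool._≟_ v c
-- Probing `c` again reveals nothing new: the budget drops and the dimension stays.
defeat {m = suc m} c (s≤s k≤m) (probe v f) | yes refl =
  let F , Fc≡𝟏 , wins = defeat c (m≤n⇒m≤1+n k≤m) (f 𝟏ⱽ)
  in F , Fc≡𝟏 , λ s run → wins s (subst (λ y → Yields (f y) ⟦ F ⟧ s) Fc≡𝟏 run)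
defeat {m = suc m} c (s≤s k≤m) (probe v f) | no v≢c = steer p c d F , steer-𝟏 p c d F Fd≡𝟏 , λ s run sink →
    wins _ (shearStrategy-yields p w b F (f y) s (subst (λ y → Yields (f y) ⟦ steer p c d F ⟧ s) answer run))
         (sink-shear p w b F s sink)
  where
  p = proj₁ (differ v≢c)
  -- As `v` differs from `c` at `p`, it lies on the facet of the sink and projects to its own
  -- restriction. Sending `c` there too lets one all-ones value at `d` account for both answers.
  d = rest p v
  w = rest p c ⊕ d
  b = not (lookup c p)
  -- The answer is settled before `F` exists, so the recursion can run on `f y`; `answer` confirms
  -- it afterwards.
  y = insertAt 𝟏ⱽ p false
  t≡0 : lookup v p xor b ≡ false
  t≡0 = ≢⇒xor-not (proj₂ (differ v≢c))
  rec = defeat d k≤m (shearStrategy p w b (f y))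
  F = proj₁ rec
  Fd≡𝟏 = proj₁ (proj₂ rec)
  wins = proj₂ (proj₂ rec)
  answer : ⟦ steer p c d F ⟧ v ≡ y
  answer = cong₂ (λ x t → insertAt x p t) (trans (cong ⟦ F ⟧ (shear-trivial p w b v t≡0)) Fd≡𝟏) t≡0

theorem1 : (𝒜 : Algorithm) → SinkFinding 𝒜 → (n : ℕ) → 2 ≤ n → Σ[ o ∈ Orientation n ] (IsMatoušekUSO o × ((k : ℕ) → FindsSinkWith 𝒜 o k → n ≤ k))
theorem1 𝒜 _ (suc zero) (s≤s ())
theorem1 𝒜 _ (suc (suc m)) _ with 𝒜 (suc (suc m)) [] in first
... | output s = orientation F , ⟦⟧-isMatoušekUSO F , slow
  -- No answer has been revealed yet, so any vertex can serve as the base; `s` is at hand.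
  where
  F,wins = defeat {k = zero} s z≤n (halt s)
  F = proj₁ F,wins
  slow : ∀ k → FindsSinkWith 𝒜 (orientation F) k → suc (suc m) ≤ k
  slow _ (s′ , stop eq , sink) with refl ← trans (sym first) eq =
    contradiction sink (proj₂ (proj₂ F,wins) s refl)
  slow _ (s′ , ask eq _ , sink) with () ← trans (sym first) eq
... | query c = orientation F , ⟦⟧-isMatoušekUSO F , slow
  where
  -- The first query costs no dimension, so a budget of `m` for the later ones covers every run with
  -- fewer than `suc (suc m)` queries.
  T = truncate (𝒜 (suc (suc m))) m ((c , 𝟏ⱽ) ∷ [])
  F,wins = defeat c ≤-refl T
  F = proj₁ F,wins
  slow : ∀ k → FindsSinkWith 𝒜 (orientation F) k → suc (suc m) ≤ k
  slow _ (s , stop eq , sink) with () ← trans (sym first) eq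
  slow (suc k) (s , ask eq run , sink) with refl ← trans (sym first) eq = ≰⇒> λ { (s≤s k≤m) →
    proj₂ (proj₂ F,wins) s
      (truncate-yields 𝒜 (orientation F) k≤m
        (subst (λ y → Outputs 𝒜 (orientation F) ((c , y) ∷ []) s k) (proj₁ (proj₂ F,wins)) run))
      sink }
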